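{- Let $T$ be a monoid, $M$ a finitary $T$-graded monad on $\mathbf{Set}$ (each $M_t$ preserves directed colimits), and $\mathcal{L}=(\Theta,\mathcal{O},\Lambda)$ a graded coalgebraic modal logic for $M$ with truth-value set $\Omega$ such that $\Lambda$ is separating and $\mathcal{O}\cup\Theta$ is functionally complete (i.e. every function $\Omega^n\to\Omega$, $n\in\mathbb{N}$, arises by composing operators in $\mathcal{O}$ and $\Theta$). Then $\mathcal{L}$ is expressive for behavioural equivalence: if states $x\in X$ and $y\in Y$ of graded $M$-coalgebras $(X,\gamma)$ and $(Y,\delta)$ satisfy $[\![\phi]\!]_\gamma(x)=[\![\phi]\!]_\delta(y)$ for all formulae $\phi$ of $\mathcal{L}$, then $x$ and $y$ are behaviourally equivalent.
   Context: A $T$-graded monad $M$ on $\mathbf{Set}$, for a monoid $(T,\cdot,e)$, consists of endofunctors $M_t$ ($t\in T$) and natural transformations $\mu^{s,t}\colon M_sM_t\to M_{s\cdot t}$, $\eta\colon\mathrm{Id}\to M_e$ such that $\mu^{r,s\cdot t}\circ M_r\mu^{s,t}=\mu^{r\cdot s,t}\circ\mu^{r,s}M_t$ and $\mu^{t,e}\circ M_t\eta=\mathrm{id}=\mu^{e,t}\circ\eta M_t$. A graded $M$-coalgebra is a set $X$ with maps $\gamma_t\colon X\to M_tX$ such that $\gamma_e=\eta_X$ and $\gamma_{s\cdot t}=\mu^{s,t}_X\circ M_s\gamma_t\circ\gamma_s$. A homomorphism $h\colon(X,\gamma)\to(Y,\delta)$ is a map with $M_th\circ\gamma_t=\delta_t\circ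 h$ for all $t$. States $x\in X$, $y\in Y$ are behaviourally equivalent if there are a graded $M$-coalgebra $(Z,\xi)$ and homomorphisms $g\colon(X,\gamma)\to(Z,\xi)$, $h\colon(Y,\delta)\to(Z,\xi)$ with $g(x)=h(y)$. A graded coalgebraic modal logic $\mathcal{L}=(\Theta,\mathcal{O},\Lambda)$ consists of a set $\Theta$ of constants, a set $\mathcal{O}$ of propositional operators $p$ with finite arities $\mathrm{ar}(p)\in\mathbb{N}$, and a set $\Lambda$ of (unary) modal operators $\lambda$ with depths $\mathsf{d}(\lambda)\in T$. Formulae are generated by $\phi::=\theta\mid p(\phi_1,\dots,\phi_{\mathrm{ar}(p)})\mid\lambda\phi$. The semantics is given by a set $\Omega$ of truth values, elements $\hat\theta\colon1\to\Omega$, maps $[\![p]\!]\colon\Omega^{\mathrm{ar}(p)}\to\Omega$ and maps $[\![\lambda]\!]\colon M_{\mathsf{d}(\lambda)}\Omega\to\Omega$. For a graded coalgebra $(X,\gamma)$, the map $[\![\phi]\!]_\gamma\colon X\to\Omega$ is defined by: $[\![\theta]\!]_\gamma$ is constant with value $\hat\theta$; $[\![p(\phi_1,\dots,\phi_n)]\!]_\gamma=[\![p]\!]\circ\langle[\![\phi_1]\!]_\gamma,\dots,[\![\phi_n]\!]_\gamma\rangle$; $[\![\lambda\phi]\!]_\gamma=[\![\lambda]\!]\circ M_{\mathsf{d}(\lambda)}[\![\phi]\!]_\gamma\circ\gamma_{\mathsf{d}(\lambda)}$. $\Lambda$ is separating if there is a generating set $G$ of the monoid $T$ such that for all sets $X$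 and all $g\in G$ the family of maps $\{[\![\lambda]\!]\circ M_gf\colon M_gX\to\Omega\mid f\colon X\to\Omega,\ \lambda\in\Lambda,\ \mathsf{d}(\lambda)=g\}$ is jointly injective. -}

module Defs where

open import Algebra.Core using (Op₂)
open import Algebra.Structures using (IsMonoid)
open import Data.Fin.Base using (Fin)
open import Data.Nat.Base using (ℕ)
open import Data.Product.Base using (Σ-syntax; ∃-syntax; _×_)
open import Data.Vec.Functional using (Vector)
open import Function.Base using (_∘_; id)
open import Level using (Level; suc)
open import Relation.Binary.Core using (Rel)
open import Relation.Binary.PropositionalEquality
  using (_≡_; _≗_; sym; trans; subst)
open import Relation.Binary.Structures using (IsPartialOrder)
open import Relation.Unary using (Pred)

private
  variable
    ℓ : Level

-- The category of sets is modelled by the types in Set ℓ, with _≡_ as equality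
-- of elements and _≗_ as equality of maps.  Under excluded middle and function
-- extensionality (taken as hypotheses where the results are stated) every type
-- in Set ℓ has unique identity proofs, _≗_ coincides with _≡_, and quotients
-- exist, so this behaves as the classical category of sets.

-- F-resp-≗ is automatic under function extensionality.

record Endofunctor (ℓ : Level) : Set (suc ℓ) where
  field
    F₀           : Set ℓ → Set ℓ
    F₁           : {A B : Set ℓ} → (A → B) → F₀ A → F₀ B
    F-resp-≗     : {A B : Set ℓ} {f g : A → B} → f ≗ g → F₁ f ≗ F₁ g
    identity     : {A : Set ℓ} → F₁ (id {A = A}) ≗ id
    homomorphism : {A B C : Set ℓ} (f : A → B) (g : B → C) →
                   F₁ (g ∘ f) ≗ F₁ g ∘ F₁ f

record DirectedPoset (ℓ : Level) : Set (suc ℓ) where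
  field
    Carrier        : Set ℓ
    _≤_            : Rel Carrier ℓ
    isPartialOrder : IsPartialOrder _≡_ _≤_
    inhabitant     : Carrier
    upperBound     : ∀ i j → ∃[ k ] (i ≤ k × j ≤ k)

-- A functor on the poset regarded as a thin category.  Since _≤_ need not be
-- proof-irrelevant, the laws range over all proofs of the inequalities, so that
-- map does not depend on the chosen proof.

record Diagram (I : DirectedPoset ℓ) : Set (suc ℓ) where
  open DirectedPoset I
  field
    obj    : Carrier → Set ℓ
    map    : ∀ {i j} → i ≤ j → obj i → obj j
    map-id : ∀ {i} (p : i ≤ i) → map p ≗ id
    map-∘  : ∀ {i j k} (p : i ≤ j) (q : j ≤ k) (r : i ≤ k) →
             map r ≗ map q ∘ map p

record Cocone {I : DirectedPoset ℓ} (D : Diagram I) : Set (suc ℓ) where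
  open DirectedPoset I
  open Diagram D
  field
    apex     : Set ℓ
    leg      : ∀ i → obj i → apex
    commutes : ∀ {i j} (p : i ≤ j) → leg j ∘ map p ≗ leg i

IsColimit : {I : DirectedPoset ℓ} {D : Diagram I} → Cocone D → Set (suc ℓ)
IsColimit {D = D} C = (K : Cocone D) →
    Σ[ u ∈ (apex C → apex K) ]
      ((∀ i → u ∘ leg C i ≗ leg K i) ×
       (∀ (v : apex C → apex K) → (∀ i → v ∘ leg C i ≗ leg K i) → v ≗ u))
  where open Cocone

module _ (F : Endofunctor ℓ) {I : DirectedPoset ℓ} where
  open Endofunctor F

  mapDiagram : Diagram I → Diagram I
  mapDiagram D = record
    { obj    = F₀ ∘ obj
    ; map    = F₁ ∘ map
    ; map-id = λ p x → trans (F-resp-≗ (map-id p) x) (identity x)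
    ; map-∘  = λ p q r x →
        trans (F-resp-≗ (map-∘ p q r) x) (homomorphism (map p) (map q) x)
    }
    where open Diagram D

  mapCocone : {D : Diagram I} → Cocone D → Cocone (mapDiagram D)
  mapCocone {D} C = record
    { apex     = F₀ apex
    ; leg      = F₁ ∘ leg
    ; commutes = λ {i} {j} p x →
        trans (sym (homomorphism (map p) (leg j) x)) (F-resp-≗ (commutes p) x)
    }
    where open Diagram D
          open Cocone C

Finitary : Endofunctor ℓ → Set (suc ℓ)
Finitary {ℓ} F = {I : DirectedPoset ℓ} {D : Diagram I} (C : Cocone D) →
                 IsColimit C → IsColimit (mapCocone F C)

-- A monoid in the category of sets above.  The standard library's Monoid bundle
-- carries its own equality, along which families indexed by the elements of the
-- monoid could not be transported.

record SetMonoid (ℓ : Level) : Set (suc ℓ) where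
  infixl 7 _∙_
  field
    Carrier  : Set ℓ
    _∙_      : Op₂ Carrier
    ε        : Carrier
    isMonoid : IsMonoid _≡_ _∙_ ε

  open IsMonoid isMonoid public using (assoc; identityˡ; identityʳ)

module _ (T : SetMonoid ℓ) where
  open SetMonoid T

  data Submonoid⟨_⟩ (G : Pred Carrier ℓ) : Pred Carrier ℓ where
    gen  : ∀ {t} → G t → Submonoid⟨ G ⟩ t
    unit : Submonoid⟨ G ⟩ ε
    mult : ∀ {s t} → Submonoid⟨ G ⟩ s → Submonoid⟨ G ⟩ t →
           Submonoid⟨ G ⟩ (s ∙ t)

  Generates : Pred Carrier ℓ → Set ℓ
  Generates G = ∀ t → Submonoid⟨ G ⟩ t

-- The two sides of each monad law live over grades that are equal by a monoid
-- law but not definitionally so, hence the transports.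

record GradedMonad (T : SetMonoid ℓ) : Set (suc ℓ) where
  open SetMonoid T
  field
    functor : Carrier → Endofunctor ℓ

  M₀ : Carrier → Set ℓ → Set ℓ
  M₀ t = Endofunctor.F₀ (functor t)

  M₁ : ∀ t {A B : Set ℓ} → (A → B) → M₀ t A → M₀ t B
  M₁ t = Endofunctor.F₁ (functor t)

  field
    μ : ∀ s t {X : Set ℓ} → M₀ s (M₀ t X) → M₀ (s ∙ t) X
    η : {X : Set ℓ} → X → M₀ ε X

    μ-natural : ∀ s t {X Y : Set ℓ} (f : X → Y) →
                μ s t ∘ M₁ s (M₁ t f) ≗ M₁ (s ∙ t) f ∘ μ s t
    η-natural : {X Y : Set ℓ} (f : X → Y) → η ∘ f ≗ M₁ ε f ∘ η

    μ-assoc : ∀ r s t {X : Set ℓ} (m : M₀ r (M₀ s (M₀ t X))) →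
              μ r (s ∙ t) (M₁ r (μ s t) m)
                ≡ subst (λ u → M₀ u X) (assoc r s t) (μ (r ∙ s) t (μ r s m))
    μ-identityʳ : ∀ t {X : Set ℓ} (m : M₀ t X) →
                  subst (λ u → M₀ u X) (identityʳ t) (μ t ε (M₁ t η m)) ≡ m
    μ-identityˡ : ∀ t {X : Set ℓ} (m : M₀ t X) →
                  subst (λ u → M₀ u X) (identityˡ t) (μ ε t (η m)) ≡ m

module _ {T : SetMonoid ℓ} (M : GradedMonad T) where
  open SetMonoid T
  open GradedMonad M

  record GradedCoalgebra (X : Set ℓ) : Set ℓ where
    field
      γ      : ∀ t → X → M₀ t X
      γ-unit : γ ε ≗ η
      γ-mult : ∀ s t → γ (s ∙ t) ≗ μ s t ∘ M₁ s (γ t) ∘ γ s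

  open GradedCoalgebra

  IsHomomorphism : {X Y : Set ℓ} → GradedCoalgebra X → GradedCoalgebra Y →
                   (X → Y) → Set ℓ
  IsHomomorphism c d h = ∀ t → M₁ t h ∘ γ c t ≗ γ d t ∘ h

  BehaviourallyEquivalent : {X Y : Set ℓ} →
    GradedCoalgebra X → GradedCoalgebra Y → X → Y → Set (suc ℓ)
  BehaviourallyEquivalent {X} {Y} c d x y =
    Σ[ Z ∈ Set ℓ ] Σ[ e ∈ GradedCoalgebra Z ]
    Σ[ g ∈ (X → Z) ] Σ[ h ∈ (Y → Z) ]
      (IsHomomorphism c e g × IsHomomorphism d e h × g x ≡ h y)

  record ModalLogic : Set (suc ℓ) where
    field
      Θ     : Set ℓ
      𝒪     : Set ℓ
      Λ     : Set ℓ
      arity : 𝒪 → ℕ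
      depth : Λ → Carrier

      Ω     : Set ℓ
      ⟦_⟧Θ  : Θ → Ω
      ⟦_⟧𝒪  : (p : 𝒪) → Vector Ω (arity p) → Ω
      ⟦_⟧Λ  : (l : Λ) → M₀ (depth l) Ω → Ω

module _ {T : SetMonoid ℓ} {M : GradedMonad T} (L : ModalLogic M) where
  open SetMonoid T
  open GradedMonad M
  open ModalLogic L

  data Formula : Set ℓ where
    const : Θ → Formula
    op    : (p : 𝒪) → Vector Formula (arity p) → Formula
    modal : Λ → Formula → Formula

  ⟦_⟧ : Formula → {X : Set ℓ} → GradedCoalgebra M X → X → Ω
  ⟦ const θ ⟧   c x = ⟦ θ ⟧Θ
  ⟦ op p φs ⟧   c x = ⟦ p ⟧𝒪 (λ i → ⟦ φs i ⟧ c x)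
  ⟦ modal l φ ⟧ c x =
    ⟦ l ⟧Λ (M₁ (depth l) (⟦ φ ⟧ c) (GradedCoalgebra.γ c (depth l) x))

  -- Composites of the operators in 𝒪 and Θ, with n argument places.
  data Term (n : ℕ) : Set ℓ where
    var   : Fin n → Term n
    const : Θ → Term n
    op    : (p : 𝒪) → Vector (Term n) (arity p) → Term n

  eval : ∀ {n} → Term n → Vector Ω n → Ω
  eval (var i)   v = v i
  eval (const θ) v = ⟦ θ ⟧Θ
  eval (op p ts) v = ⟦ p ⟧𝒪 (λ i → eval (ts i) v)

  FunctionallyComplete : Set ℓ
  FunctionallyComplete =
    ∀ n (f : Vector Ω n → Ω) → ∃[ t ] (eval {n} t ≗ f)

  -- The operators of depth g are given as l together with l-depth : depth l ≡ g,
  -- so the argument of ⟦ l ⟧Λ has to be transported from grade g to depth l.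
  Separating : Set (suc ℓ)
  Separating =
    Σ[ G ∈ Pred Carrier ℓ ] (Generates T G ×
      (∀ (X : Set ℓ) g → G g → (m m′ : M₀ g X) →
        (∀ (f : X → Ω) (l : Λ) (l-depth : depth l ≡ g) →
          ⟦ l ⟧Λ (subst (λ u → M₀ u Ω) (sym l-depth) (M₁ g f m))
            ≡ ⟦ l ⟧Λ (subst (λ u → M₀ u Ω) (sym l-depth) (M₁ g f m′))) →
        m ≡ m′))

  LogicallyEquivalent : {X Y : Set ℓ} →
    GradedCoalgebra M X → GradedCoalgebra M Y → X → Y → Set ℓ
  LogicallyEquivalent c d x y = ∀ φ → ⟦ φ ⟧ c x ≡ ⟦ φ ⟧ d y

  Expressive : Set (suc ℓ)
  Expressive =
    {X Y : Set ℓ} (c : GradedCoalgebra M X) (d : GradedCoalgebra M Y)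
    (x : X) (y : Y) →
    LogicallyEquivalent c d x y → BehaviourallyEquivalent M c d x y

{-# OPTIONS --safe #-}
-- Form the coproduct W of the two coalgebras and quotient it by logical
-- equivalence, q : W → Z.  The quotient carries a coalgebra structure making q a
-- homomorphism as soon as M q ∘ γ is constant on classes; this property is closed
-- under the monoid operations, so it suffices to check it at the generators,
-- where by separation it is enough to compare M (f ∘ q) ∘ γ for f : Z → Ω.  By
-- finitarity two given values of γ are supported on a finite subset of W; there
-- f ∘ q agrees with a formula, because finitely many formulae distinguish the
-- finitely many classes involved and every function of their truth values is
-- definable.
module Submission where

open import Defs
open import Level using (Level; Lift; lift; lower; suc)
open import Axiom.ExcludedMiddle using (ExcludedMiddle)
open import Axiom.Extensionality.Propositional
  using (Extensionality; lower-extensionality)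
open import Axiom.UniquenessOfIdentityProofs using (module Decidable⇒UIP)
open import Data.Bool.Base using (Bool; true; T)
open import Data.Bool.Properties using (T-irrelevant; T-≡)
open import Data.Fin.Base using (combine; remQuot)
open import Data.Fin.Properties using (remQuot-combine)
open import Data.List.Base using (List; []; [_]; _++_; length)
import Data.List.Base as List
open import Data.List.Membership.Propositional using (_∈_)
open import Data.List.Membership.Propositional.Properties
  using (∈-++⁺ˡ; ∈-++⁺ʳ)
open import Data.List.Relation.Binary.Sublist.Propositional
  using (_⊆_; ⊆-refl; ⊆-isPartialOrder; lookup; from∈)
open import Data.List.Relation.Binary.Sublist.Propositional.Properties
  using (++⁺ˡ; ++⁺ʳ)
open import Data.List.Relation.Unary.Any using (here; index)
open import Data.List.Relation.Unary.Any.Properties using (lookup-index)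
open import Data.Nat.Base using (_*_)
open import Data.Product.Base
  using (Σ; Σ-syntax; ∃-syntax; _×_; _,_; proj₁; proj₂)
open import Data.Sum.Base using (_⊎_; inj₁; inj₂)
open import Data.Vec.Functional using (Vector)
open import Function.Base using (_∘_)
open import Function.Bundles using (Equivalence)
open import Relation.Binary.Core using (Rel)
open import Relation.Binary.PropositionalEquality
  using (_≡_; _≗_; refl; sym; trans; cong; subst; module ≡-Reasoning)
open import Relation.Binary.Structures using (IsEquivalence)
open import Relation.Nullary using (¬_; yes; no; contradiction)
open import Relation.Nullary.Decidable
  using (isYes; True; toWitness; fromWitness; decidable-stable)

private
  variable
    ℓ : Level

Σ-≡ : {A : Set ℓ} {b : Level} {B : A → Set b} →
      (∀ a (p q : B a) → p ≡ q) →
      {x y : Σ A B} → proj₁ x ≡ proj₁ y → x ≡ y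
Σ-≡ irr {a , p} {.a , q} refl = cong (a ,_) (irr a p q)

-- Finite supports

module _ (em : ExcludedMiddle ℓ) where

  -- A colimit admits only one map to Bool that is true on all legs, and the
  -- characteristic map of the union of their images is one.
  colimit-jointly-surjective :
    {I : DirectedPoset ℓ} {D : Diagram I} (C : Cocone D) → IsColimit C →
    ∀ a → ∃[ i ] ∃[ y ] (Cocone.leg C i y ≡ a)
  colimit-jointly-surjective {I = I} {D} C colim a =
    toWitness {a? = em} (Equivalence.from T-≡ inImage-true)
    where
    open Cocone C

    InImage : apex → Set _
    InImage b = ∃[ i ] ∃[ y ] (leg i y ≡ b)

    inImage : apex → Lift _ Bool
    inImage b = lift (isYes (em {InImage b}))

    trueCocone : Cocone D
    trueCocone = record
      { apex     = Lift _ Bool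
      ; leg      = λ _ _ → lift true
      ; commutes = λ _ _ → refl
      }

    inImage-leg : ∀ i → inImage ∘ leg i ≗ (λ _ → lift true)
    inImage-leg i y = cong lift
      (Equivalence.to T-≡ (fromWitness {a? = em {InImage (leg i y)}} (i , y , refl)))

    inImage-true : isYes (em {InImage a}) ≡ true
    inImage-true = cong lower
      (trans (unique inImage inImage-leg a)
             (sym (unique (λ _ → lift true) (λ _ _ → refl) a)))
      where unique = proj₂ (proj₂ (colim trueCocone))

  -- The sublist order, unlike inclusion of lists, is antisymmetric.
  listPoset : Set ℓ → DirectedPoset ℓ
  listPoset W = record
    { Carrier        = List W
    ; _≤_            = _⊆_
    ; isPartialOrder = ⊆-isPartialOrder
    ; inhabitant     = []
    ; upperBound     = λ xs ys → xs ++ ys , ++⁺ʳ ys ⊆-refl , ++⁺ˡ xs ⊆-refl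
    }

  module _ (W : Set ℓ) where

    -- A list may contain `w` several times, so `w ∈ xs` may have several proofs. `True` has at most
    -- one, which makes `Elements xs` a subset of `W` and `include` independent of the embedding of
    -- lists.
    Elements : List W → Set ℓ
    Elements xs = Σ[ w ∈ W ] True (em {w ∈ xs})

    Elements-≡ : ∀ {xs} {x y : Elements xs} → proj₁ x ≡ proj₁ y → x ≡ y
    Elements-≡ = Σ-≡ (λ _ → T-irrelevant)

    include : ∀ {xs ys} → xs ⊆ ys → Elements xs → Elements ys
    include xs⊆ys (w , w∈xs) = w , fromWitness (lookup xs⊆ys (toWitness w∈xs))

    elementsDiagram : Diagram (listPoset W)
    elementsDiagram = record
      { obj    = Elements
      ; map    = include
      ; map-id = λ _ _ → Elements-≡ refl
      ; map-∘  = λ _ _ _ _ → Elements-≡ refl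
      }

    elementsCocone : Cocone elementsDiagram
    elementsCocone = record
      { apex     = W
      ; leg      = λ _ → proj₁
      ; commutes = λ _ _ → refl
      }

    -- The list `[ w ]` embeds into every list containing `w`, so the leg at `[ w ]` determines both
    -- the mediating map and its uniqueness.
    elementsColimit : IsColimit elementsCocone
    elementsColimit K =
      (λ w → leg [ w ] (single w)) ,
      (λ xs (w , w∈xs) → trans
        (sym (commutes (from∈ (toWitness w∈xs)) (single w)))
        (cong (leg xs) (Elements-≡ {xs} refl))) ,
      (λ v v-leg w → v-leg [ w ] (single w))
      where
      open Cocone K
      single : ∀ w → Elements [ w ]
      single w = w , fromWitness (here refl)

  -- By finitarity `m` is the image of some `y` over a finite subset of `W`, and `f` and `g` have
  -- the same restriction to that subset.
  finite-support :
    (F : Endofunctor ℓ) → Finitary F → let open Endofunctor F in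
    {W : Set ℓ} (m : F₀ W) →
    ∃[ xs ] ({B : Set ℓ} (f g : W → B) →
             (∀ {w} → w ∈ xs → f w ≡ g w) → F₁ f m ≡ F₁ g m)
  finite-support F finitary {W} m
    with colimit-jointly-surjective (mapCocone F (elementsCocone W))
           (finitary (elementsCocone W) (elementsColimit W)) m
  ... | xs , y , refl = xs , λ f g f≡g → begin
    F₁ f (F₁ proj₁ y)  ≡⟨ homomorphism proj₁ f y ⟨
    F₁ (f ∘ proj₁) y   ≡⟨ F-resp-≗ (λ (_ , w∈xs) → f≡g (toWitness w∈xs)) y ⟩
    F₁ (g ∘ proj₁) y   ≡⟨ homomorphism proj₁ g y ⟩
    F₁ g (F₁ proj₁ y)  ∎
    where open Endofunctor F
          open ≡-Reasoning

-- Quotients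

record Quotient {W : Set ℓ} (_≈_ : Rel W ℓ) : Set (suc ℓ) where
  field
    Class       : Set ℓ
    class       : W → Class
    rep         : Class → W
    class∘rep   : ∀ z → class (rep z) ≡ z
    rep∘class   : ∀ w → rep (class w) ≈ w
    class-cong  : ∀ {v w} → v ≈ w → class v ≡ class w

-- ExcludedMiddle decides all types, not only propositions, so it selects an
-- element of each inhabited type.  Representing a class by its characteristic
-- function makes the selected element depend on the class alone.
quotient : ExcludedMiddle ℓ → Extensionality ℓ ℓ →
           {W : Set ℓ} {_≈_ : Rel W ℓ} → IsEquivalence _≈_ → Quotient _≈_
quotient {ℓ} em ext {W} {_≈_} isEquivalence = record
  -- Classes are encoded as the fixed points of a choice of representatives.
  { Class      = Σ[ w ∈ W ] canonical w ≡ w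
  ; class      = λ w → canonical w , canonical-cong (canonical-≈ w)
  ; rep        = proj₁
  ; class∘rep  = λ (_ , fixed) → Class-≡ fixed
  ; rep∘class  = canonical-≈
  ; class-cong = λ v≈w → Class-≡ (canonical-cong v≈w)
  }
  where
  module ≈ = IsEquivalence isEquivalence

  χ : W → W → Bool
  χ v w = isYes (em {v ≈ w})

  χ-cong : ∀ {v w} → v ≈ w → χ v ≡ χ w
  χ-cong {v} {w} v≈w = lower-extensionality ℓ ℓ ext pointwise
    where
    pointwise : χ v ≗ χ w
    pointwise u with em {v ≈ u} | em {w ≈ u}
    ... | yes _   | yes _   = refl
    ... | no _    | no _    = refl
    ... | yes v≈u | no w≉u  = contradiction (≈.trans (≈.sym v≈w) v≈u) w≉u
    ... | no v≉u  | yes w≈u = contradiction (≈.trans v≈w w≈u) v≉u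

  select : (P : W → Bool) → True (em {Σ W (T ∘ P)}) → Σ W (T ∘ P)
  select P = toWitness

  χ-inhabited : ∀ w → True (em {Σ W (T ∘ χ w)})
  χ-inhabited w = fromWitness (w , fromWitness {a? = em} ≈.refl)

  canonical : W → W
  canonical w = proj₁ (select (χ w) (χ-inhabited w))

  canonical-≈ : ∀ w → canonical w ≈ w
  canonical-≈ w =
    ≈.sym (toWitness {a? = em} (proj₂ (select (χ w) (χ-inhabited w))))

  select-cong : ∀ {P Q} → P ≡ Q → ∀ p q →
                proj₁ (select P p) ≡ proj₁ (select Q q)
  select-cong {P} refl p q = cong (proj₁ ∘ select P) (T-irrelevant p q)

  canonical-cong : ∀ {v w} → v ≈ w → canonical v ≡ canonical w
  canonical-cong v≈w = select-cong (χ-cong v≈w) _ _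

  -- Equality on `W` is decided by `em`, so proofs of `canonical w ≡ w` are unique by Hedberg's
  -- theorem.
  Class-≡ : {x y : Σ[ w ∈ W ] canonical w ≡ w} → proj₁ x ≡ proj₁ y → x ≡ y
  Class-≡ = Σ-≡ (λ _ → Decidable⇒UIP.≡-irrelevant (λ _ _ → em))

-- Graded coalgebras

module _ {T : SetMonoid ℓ} (M : GradedMonad T) where
  open SetMonoid T
  open GradedMonad M
  open GradedCoalgebra
  open ≡-Reasoning

  private
    module M t = Endofunctor (functor t)

  module _ {X Z : Set ℓ} (c : GradedCoalgebra M X) (h : X → Z)
           (δ : ∀ t → Z → M₀ t Z) where

    -- Here `δ` is a bare family of maps: coalgebra laws pass along `h` to its image, which serves
    -- coproducts and quotients alike.
    image-unit : M₁ ε h ∘ γ c ε ≗ δ ε ∘ h → δ ε ∘ h ≗ η ∘ h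
    image-unit hom x = begin
      δ ε (h x)         ≡⟨ hom x ⟨
      M₁ ε h (γ c ε x)  ≡⟨ cong (M₁ ε h) (γ-unit c x) ⟩
      M₁ ε h (η x)      ≡⟨ η-natural h x ⟨
      η (h x)           ∎

    -- Nothing is assumed at grade `s ∙ t`, hence the left-hand side avoids `δ (s ∙ t)`. This lets
    -- `compatible-∙` use the equation before compatibility at `s ∙ t` is known.
    image-mult :
      ∀ s t → M₁ s h ∘ γ c s ≗ δ s ∘ h → M₁ t h ∘ γ c t ≗ δ t ∘ h →
      M₁ (s ∙ t) h ∘ γ c (s ∙ t) ≗ μ s t ∘ M₁ s (δ t) ∘ δ s ∘ h
    image-mult s t hom-s hom-t x = begin
      M₁ (s ∙ t) h (γ c (s ∙ t) x)
        ≡⟨ cong (M₁ (s ∙ t) h) (γ-mult c s t x) ⟩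
      M₁ (s ∙ t) h (μ s t (M₁ s (γ c t) (γ c s x)))
        ≡⟨ μ-natural s t h _ ⟨
      μ s t (M₁ s (M₁ t h) (M₁ s (γ c t) (γ c s x)))
        ≡⟨ cong (μ s t) (M.homomorphism s (γ c t) (M₁ t h) _) ⟨
      μ s t (M₁ s (M₁ t h ∘ γ c t) (γ c s x))
        ≡⟨ cong (μ s t) (M.F-resp-≗ s hom-t _) ⟩
      μ s t (M₁ s (δ t ∘ h) (γ c s x))
        ≡⟨ cong (μ s t) (M.homomorphism s h (δ t) _) ⟩
      μ s t (M₁ s (δ t) (M₁ s h (γ c s x)))
        ≡⟨ cong (μ s t ∘ M₁ s (δ t)) (hom-s x) ⟩
      μ s t (M₁ s (δ t) (δ s (h x)))
        ∎

  homomorphism-∘ :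
    {X Y Z : Set ℓ} (c : GradedCoalgebra M X) (d : GradedCoalgebra M Y)
    (e : GradedCoalgebra M Z) {h : X → Y} {k : Y → Z} →
    IsHomomorphism M c d h → IsHomomorphism M d e k →
    IsHomomorphism M c e (k ∘ h)
  homomorphism-∘ c d e {h} {k} h-hom k-hom t x = begin
    M₁ t (k ∘ h) (γ c t x)     ≡⟨ M.homomorphism t h k _ ⟩
    M₁ t k (M₁ t h (γ c t x))  ≡⟨ cong (M₁ t k) (h-hom t x) ⟩
    M₁ t k (γ d t (h x))       ≡⟨ k-hom t (h x) ⟩
    γ e t (k (h x))            ∎

  module _ {X Y : Set ℓ} (c : GradedCoalgebra M X) (d : GradedCoalgebra M Y)
           where

    coproduct-γ : ∀ t → X ⊎ Y → M₀ t (X ⊎ Y)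
    coproduct-γ t (inj₁ x) = M₁ t inj₁ (γ c t x)
    coproduct-γ t (inj₂ y) = M₁ t inj₂ (γ d t y)

    coproduct : GradedCoalgebra M (X ⊎ Y)
    coproduct = record
      { γ      = coproduct-γ
      ; γ-unit = λ where
          (inj₁ x) → image-unit c inj₁ coproduct-γ (λ _ → refl) x
          (inj₂ y) → image-unit d inj₂ coproduct-γ (λ _ → refl) y
      ; γ-mult = λ where
          s t (inj₁ x) →
            image-mult c inj₁ coproduct-γ s t (λ _ → refl) (λ _ → refl) x
          s t (inj₂ y) →
            image-mult d inj₂ coproduct-γ s t (λ _ → refl) (λ _ → refl) y
      }

    inj₁-homomorphism : IsHomomorphism M c coproduct inj₁
    inj₁-homomorphism t x = refl

    inj₂-homomorphism : IsHomomorphism M d coproduct inj₂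
    inj₂-homomorphism t y = refl

  -- Quotients of graded coalgebras

  module _ {W : Set ℓ} (c : GradedCoalgebra M W)
           {_≈_ : Rel W ℓ} (Q : Quotient _≈_) where
    open Quotient Q

    CompatibleAt : Carrier → Set ℓ
    CompatibleAt t = ∀ {a b} → a ≈ b →
                     M₁ t class (γ c t a) ≡ M₁ t class (γ c t b)

    quotient-γ : ∀ t → Class → M₀ t Class
    quotient-γ t z = M₁ t class (γ c t (rep z))

    quotient-hom : ∀ {t} → CompatibleAt t →
                   M₁ t class ∘ γ c t ≗ quotient-γ t ∘ class
    quotient-hom compatible w = sym (compatible (rep∘class w))

    compatible-ε : CompatibleAt ε
    compatible-ε {a} {b} a≈b = begin
      M₁ ε class (γ c ε a)  ≡⟨ class-η a ⟩
      η (class a)           ≡⟨ cong η (class-cong a≈b) ⟩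
      η (class b)           ≡⟨ class-η b ⟨
      M₁ ε class (γ c ε b)  ∎
      where
      class-η : M₁ ε class ∘ γ c ε ≗ η ∘ class
      class-η w =
        trans (cong (M₁ ε class) (γ-unit c w)) (sym (η-natural class w))

    -- Compatibility at `s` and `t` makes `M₁ (s ∙ t) class ∘ γ c (s ∙ t)` factor through `class`,
    -- with `μγ` as the other factor.
    compatible-∙ : ∀ {s t} → CompatibleAt s → CompatibleAt t →
                   CompatibleAt (s ∙ t)
    compatible-∙ {s} {t} comp-s comp-t {a} {b} a≈b = begin
      M₁ (s ∙ t) class (γ c (s ∙ t) a)  ≡⟨ class-γ a ⟩
      μγ (class a)                      ≡⟨ cong μγ (class-cong a≈b) ⟩
      μγ (class b)                      ≡⟨ class-γ b ⟨
      M₁ (s ∙ t) class (γ c (s ∙ t) b)  ∎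
      where
      μγ = μ s t ∘ M₁ s (quotient-γ t) ∘ quotient-γ s
      class-γ = image-mult c class quotient-γ s t
                  (quotient-hom comp-s) (quotient-hom comp-t)

    compatible-generated : ∀ {G} → (∀ {g} → G g → CompatibleAt g) →
                           ∀ {t} → Submonoid⟨_⟩ T G t → CompatibleAt t
    compatible-generated comp (gen Gg)   = comp Gg
    compatible-generated comp unit       = compatible-ε
    compatible-generated comp (mult p q) =
      compatible-∙ (compatible-generated comp p) (compatible-generated comp q)

    module _ (compatible : ∀ t → CompatibleAt t) where

      quotientCoalgebra : GradedCoalgebra M Class
      quotientCoalgebra = record
        { γ      = quotient-γ
        ; γ-unit = λ z → subst (λ z → quotient-γ ε z ≡ η z) (class∘rep z)
            (image-unit c class quotient-γ (class-hom ε) (rep z))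
        -- `quotient-γ (s ∙ t) z` unfolds to the left-hand side of `image-mult` at `rep z`, so only
        -- the right-hand side needs `class∘rep`.
        ; γ-mult = λ s t z →
            trans
              (image-mult c class quotient-γ s t
                 (class-hom s) (class-hom t) (rep z))
              (cong (μ s t ∘ M₁ s (quotient-γ t) ∘ quotient-γ s) (class∘rep z))
        }
        where
        class-hom : ∀ t → M₁ t class ∘ γ c t ≗ quotient-γ t ∘ class
        class-hom t = quotient-hom (compatible t)

      class-homomorphism : IsHomomorphism M c quotientCoalgebra class
      class-homomorphism t = quotient-hom (compatible t)

-- Formulae

module _ {T : SetMonoid ℓ} {M : GradedMonad T} (L : ModalLogic M)
         (ext : Extensionality ℓ ℓ) where
  open SetMonoid T
  open GradedMonad M
  open GradedCoalgebra
  open ModalLogic L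
  open ≡-Reasoning

  private
    module M t = Endofunctor (functor t)

    Vector-ext : ∀ {n} {u v : Vector Ω n} → u ≗ v → u ≡ v
    Vector-ext = lower-extensionality ℓ ℓ ext

  -- This moves logical equivalence of states of two coalgebras into their coproduct.
  ⟦⟧-homomorphism :
    {X Y : Set ℓ} {c : GradedCoalgebra M X} {d : GradedCoalgebra M Y}
    {h : X → Y} → IsHomomorphism M c d h →
    ∀ φ → ⟦_⟧ L φ c ≗ ⟦_⟧ L φ d ∘ h
  ⟦⟧-homomorphism hom (const θ)   x = refl
  ⟦⟧-homomorphism hom (op p φs)   x =
    cong ⟦ p ⟧𝒪 (Vector-ext (λ i → ⟦⟧-homomorphism hom (φs i) x))
  ⟦⟧-homomorphism {c = c} {d} {h} hom (modal l φ) x = cong ⟦ l ⟧Λ (begin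
    M₁ t (⟦_⟧ L φ c) (γ c t x)
      ≡⟨ M.F-resp-≗ t (⟦⟧-homomorphism hom φ) _ ⟩
    M₁ t (⟦_⟧ L φ d ∘ h) (γ c t x)
      ≡⟨ M.homomorphism t h (⟦_⟧ L φ d) _ ⟩
    M₁ t (⟦_⟧ L φ d) (M₁ t h (γ c t x))
      ≡⟨ cong (M₁ t (⟦_⟧ L φ d)) (hom t x) ⟩
    M₁ t (⟦_⟧ L φ d) (γ d t (h x))
      ∎)
    where t = depth l

  instantiate : ∀ {n} → Term L n → Vector (Formula L) n → Formula L
  instantiate (var i)   φs = φs i
  instantiate (const θ) φs = const θ
  instantiate (op p ts) φs = op p (λ i → instantiate (ts i) φs)

  module _ {W : Set ℓ} (c : GradedCoalgebra M W) where

    ⟦instantiate⟧ : ∀ {n} (t : Term L n) φs w →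
      ⟦_⟧ L (instantiate t φs) c w ≡ eval L t (λ i → ⟦_⟧ L (φs i) c w)
    ⟦instantiate⟧ (var i)   φs w = refl
    ⟦instantiate⟧ (const θ) φs w = refl
    ⟦instantiate⟧ (op p ts) φs w =
      cong ⟦ p ⟧𝒪 (Vector-ext (λ i → ⟦instantiate⟧ (ts i) φs w))

    infix 4 _≈_
    _≈_ : Rel W ℓ
    _≈_ = LogicallyEquivalent L c c

    ≈-isEquivalence : IsEquivalence _≈_
    ≈-isEquivalence = record
      { refl  = λ _ → refl
      ; sym   = λ v≈w φ → sym (v≈w φ)
      ; trans = λ u≈v v≈w φ → trans (u≈v φ) (v≈w φ)
      }

    -- Interpolation by formulae

    module _ (em : ExcludedMiddle ℓ) (complete : FunctionallyComplete L) where

      definable : ∀ {n} (F : Vector Ω n → Ω) (φs : Vector (Formula L) n) →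
        ∃[ φ ] ∀ w → ⟦_⟧ L φ c w ≡ F (λ i → ⟦_⟧ L (φs i) c w)
      definable F φs with complete _ F
      ... | t , t≗F = instantiate t φs ,
                      λ w → trans (⟦instantiate⟧ t φs w) (t≗F _)

      distinguishing : Ω → ∀ v w →
        ∃[ φ ] (⟦_⟧ L φ c v ≡ ⟦_⟧ L φ c w → v ≈ w)
      distinguishing ω v w
        with em {∃[ φ ] ¬ (⟦_⟧ L φ c v ≡ ⟦_⟧ L φ c w)}
      ... | yes (φ , φ-differs) = φ , λ φ-agrees → contradiction φ-agrees φ-differs
      -- Any formula will do when the states are equivalent, but one must exist: functional
      -- completeness at arity 0 turns `ω` into a closed one.
      ... | no none = proj₁ (definable {0} (λ _ → ω) λ ()) ,
                      λ _ ψ → decidable-stable em (λ ψ-differs → none (ψ , ψ-differs))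

      -- One formula is taken for each pair of positions in `xs`; `remQuot` decodes an index below
      -- `n * n` into such a pair.
      jointly-distinguishing : Ω → (xs : List W) →
        ∃[ n ] Σ[ φs ∈ Vector (Formula L) n ]
          (∀ {v w} → v ∈ xs → w ∈ xs →
           (∀ k → ⟦_⟧ L (φs k) c v ≡ ⟦_⟧ L (φs k) c w) → v ≈ w)
      jointly-distinguishing ω xs = n * n , φs ∘ remQuot n , separate
        where
        n = length xs

        φs : _ → Formula L
        φs (i , j) =
          proj₁ (distinguishing ω (List.lookup xs i) (List.lookup xs j))

        separate-lookup : ∀ i j →
          (∀ k → ⟦_⟧ L (φs (remQuot n k)) c (List.lookup xs i)
               ≡ ⟦_⟧ L (φs (remQuot n k)) c (List.lookup xs j)) →
          List.lookup xs i ≈ List.lookup xs j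
        separate-lookup i j agree =
          proj₂ (distinguishing ω (List.lookup xs i) (List.lookup xs j))
            (subst (λ ij → ⟦_⟧ L (φs ij) c (List.lookup xs i)
                         ≡ ⟦_⟧ L (φs ij) c (List.lookup xs j))
                   (remQuot-combine i j) (agree (combine i j)))

        separate : ∀ {v w} → v ∈ xs → w ∈ xs →
          (∀ k → ⟦_⟧ L (φs (remQuot n k)) c v ≡ ⟦_⟧ L (φs (remQuot n k)) c w) →
          v ≈ w
        separate v∈xs w∈xs
          rewrite lookup-index v∈xs | lookup-index w∈xs =
          separate-lookup (index v∈xs) (index w∈xs)

      interpolating : Ω → (f : W → Ω) → (∀ {v w} → v ≈ w → f v ≡ f w) →
        (xs : List W) → ∃[ φ ] (∀ {w} → w ∈ xs → f w ≡ ⟦_⟧ L φ c w)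
      interpolating ω f f-resp xs with jointly-distinguishing ω xs
      ... | n , φs , separate =
        φ , λ {w} w∈xs → sym (trans (φ-defines w) (F-values w∈xs))
        where
        values : W → Vector Ω n
        values w k = ⟦_⟧ L (φs k) c w

        Attained : Vector Ω n → Set ℓ
        Attained u = ∃[ w ] (w ∈ xs × values w ≗ u)

        F : Vector Ω n → Ω
        F u with em {Attained u}
        ... | yes (w , _) = f w
        -- An arbitrary default, since only vectors attained on `xs` matter.
        ... | no _        = ω

        F-values : ∀ {w} → w ∈ xs → F (values w) ≡ f w
        F-values {w} w∈xs with em {Attained (values w)}
        -- The chosen witness `v` may differ from `w`, but equal values make them equivalent, and
        -- `f` respects equivalence.
        ... | yes (v , v∈xs , agree) = f-resp (separate v∈xs w∈xs agree)
        ... | no ¬attained = contradiction (w , w∈xs , λ _ → refl) ¬attained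

        φ = proj₁ (definable F φs)
        φ-defines = proj₂ (definable F φs)

      -- Compatibility of logical equivalence with the coalgebra structure

      module _ (finitary : ∀ t → Finitary (functor t)) (Q : Quotient _≈_) where
        open Quotient Q

        lift-invariant : ∀ l (f : Class → Ω) {a b} → a ≈ b →
          ⟦ l ⟧Λ (M₁ (depth l) f (M₁ (depth l) class (γ c (depth l) a))) ≡
          ⟦ l ⟧Λ (M₁ (depth l) f (M₁ (depth l) class (γ c (depth l) b)))
        lift-invariant l f {a} {b} a≈b
          with finite-support em (functor (depth l)) (finitary (depth l))
                 (γ c (depth l) a)
             | finite-support em (functor (depth l)) (finitary (depth l))
                 (γ c (depth l) b)
        ... | xs , xs-supports | ys , ys-supports
          -- Both supports are covered at once, so that one `φ` replaces `f ∘ class` on either side.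
          -- The state `a` provides the truth value used as default.
          with interpolating (f (class a)) (f ∘ class) (cong f ∘ class-cong)
                 (xs ++ ys)
        ... | φ , φ-interpolates = begin
          ⟦ l ⟧Λ (M₁ t f (M₁ t class (γ c t a)))
            ≡⟨ cong ⟦ l ⟧Λ (M.homomorphism t class f _) ⟨
          ⟦ l ⟧Λ (M₁ t (f ∘ class) (γ c t a))
            ≡⟨ cong ⟦ l ⟧Λ (xs-supports _ _ (φ-interpolates ∘ ∈-++⁺ˡ)) ⟩
          ⟦_⟧ L (modal l φ) c a
            ≡⟨ a≈b (modal l φ) ⟩
          ⟦_⟧ L (modal l φ) c b
            ≡⟨ cong ⟦ l ⟧Λ (ys-supports _ _ (φ-interpolates ∘ ∈-++⁺ʳ xs)) ⟨
          ⟦ l ⟧Λ (M₁ t (f ∘ class) (γ c t b))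
            ≡⟨ cong ⟦ l ⟧Λ (M.homomorphism t class f _) ⟩
          ⟦ l ⟧Λ (M₁ t f (M₁ t class (γ c t b)))
            ∎
          where t = depth l

        logical-compatible : Separating L → ∀ t → CompatibleAt M c Q t
        logical-compatible (G , generates , jointly-injective) t =
          compatible-generated M c Q
            (λ {g} Gg a≈b → jointly-injective Class g Gg _ _
              -- Matching on `refl` identifies `g` with `depth l` and removes the transport in
              -- `Separating`.
              (λ { f l refl → lift-invariant l f a≈b }))
            (generates t)

theorem5p5 : {ℓ : Level} → ExcludedMiddle ℓ → Extensionality ℓ ℓ →
    (T : SetMonoid ℓ) (M : GradedMonad T) (L : ModalLogic M) →
    (∀ t → Finitary (GradedMonad.functor M t)) →
    Separating L →
    FunctionallyComplete L →
    Expressive L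
theorem5p5 em ext T M L finitary separating complete c d x y x≈y =
  Class , z ,
  class ∘ inj₁ , class ∘ inj₂ ,
  homomorphism-∘ M c w z (inj₁-homomorphism M c d) class-hom ,
  homomorphism-∘ M d w z (inj₂-homomorphism M c d) class-hom ,
  class-cong inj₁x≈inj₂y
  where
  w = coproduct M c d
  Q = quotient em ext (≈-isEquivalence L ext w)
  open Quotient Q
  compatible = logical-compatible L ext w em complete finitary Q separating
  z = quotientCoalgebra M w Q compatible
  class-hom = class-homomorphism M w Q compatible

  inj₁x≈inj₂y : LogicallyEquivalent L w w (inj₁ x) (inj₂ y)
  inj₁x≈inj₂y φ =
    trans (sym (⟦⟧-homomorphism L ext (inj₁-homomorphism M c d) φ x))
      (trans (x≈y φ) (⟦⟧-homomorphism L ext (inj₂-homomorphism M c d) φ y))
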